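{- Consider a nonempty configuration with largest nonempty level $\lambda$, and let $G,G'$ be integers with $A(G)<2^b$ and $A(G')<2^b$. Then every level $\ell$ with $A_\ell(G)\ne A_\ell(G')$ lies in the integer interval $[\theta(H,z),\lambda]$, where $H=\max\{G,G'\}$ and $\theta(H,z)=-b-H-\lfloor\log_2z\rfloor$, and this interval contains at most $2b$ integers. In particular, at most $2b$ levels satisfy $A_\ell(G)\neq A_\ell(G')$.
   Context: Fix an integer $b\ge 2$. There is a set $\mathcal L$ of $N$ levels, which are consecutive integers. Each level $\ell$ holds a finite (possibly empty) multiset of normalized significands, each an integer in $[2^{b-1},2^b)$. Let $z$ be the total number of stored significands over all levels; assume $z<2^b$. For each level, $SS_\ell$ is the sum of its significands (so $SS_\ell=0$ iff the level is empty); set $SS_\ell=0$ for integers $\ell\notin\mathcal L$. The level weight is $W_\ell=SS_\ell2^\ell$. For an integer global shift $G$, $A_\ell(G)=\lfloor W_\ell2^G\rfloor+1$ if $SS_\ell>0$ and $A_\ell(G)=0$ if $SS_\ell=0$; $A(G)=\sum_\ell A_\ell(G)$. The configuration is nonempty if $z\ge1$. -}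

module Defs where

open import Data.Integer.Base as ℤ using (ℤ; +_; -[1+_]; 0ℤ; 1ℤ)
open import Data.List.Base using (List; []; foldr; length; map; upTo)
open import Data.List.Membership.Propositional using (_∈_; _∉_)
open import Data.List.Relation.Unary.All using (All)
open import Data.Nat.Base as ℕ using (ℕ; zero; suc; _^_; _∸_)
open import Data.Nat.ListAction using (sum)
open import Data.Nat.Logarithm using (⌊log₂_⌋)
open import Data.Nat.Properties using (m^n≢0)
open import Data.Product.Base using (∃-syntax; _×_)
open import Data.Rational.Base as ℚ using (ℚ; floor)
open import Function.Base using (_∘_)
open import Relation.Binary.PropositionalEquality.Core using (_≡_; _≢_)

2^ᶻ_ : ℤ → ℚ
2^ᶻ (+ n)    = + (2 ^ n) ℚ./ 1
2^ᶻ -[1+ n ] = ℚ._/_ 1ℤ (2 ^ suc n) {{m^n≢0 2 (suc n)}}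

Normalized : ℕ → ℕ → Set
Normalized b s = 2 ^ (b ∸ 1) ℕ.≤ s × s ℕ.< 2 ^ b

-- Lists stand for multisets: only their sums, lengths and emptiness are used.
-- `contents` is total on ℤ and empty off the N levels lo, …, lo + N - 1, so that
-- SS below is 0 at integers which are not levels.
record Config (b : ℕ) : Set where
  field
    lo : ℤ
    N  : ℕ

  levels : List ℤ
  levels = map (λ i → lo ℤ.+ + i) (upTo N)

  field
    contents   : ℤ → List ℕ
    off-levels : ∀ {ℓ} → ℓ ∉ levels → contents ℓ ≡ []
    normalized : ∀ ℓ → All (Normalized b) (contents ℓ)

  z : ℕ
  z = sum (map (length ∘ contents) levels)

  field
    z<2^b : z ℕ.< 2 ^ b

  SS : ℤ → ℕ
  SS ℓ = sum (contents ℓ)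

  W : ℤ → ℚ
  W ℓ = (+ SS ℓ ℚ./ 1) ℚ.* 2^ᶻ ℓ

  Aₗ : ℤ → ℤ → ℤ
  Aₗ ℓ G with SS ℓ
  ... | zero  = 0ℤ
  ... | suc _ = floor (W ℓ ℚ.* 2^ᶻ G) ℤ.+ 1ℤ

  -- Aₗ vanishes off the levels, so this is the sum over all integers ℓ.
  A : ℤ → ℤ
  A G = foldr ℤ._+_ 0ℤ (map (λ ℓ → Aₗ ℓ G) levels)

  NonemptyLevel : ℤ → Set
  NonemptyLevel ℓ = ℓ ∈ levels × contents ℓ ≢ []

  LargestNonemptyLevel : ℤ → Set
  LargestNonemptyLevel ℓ = NonemptyLevel ℓ × (∀ k → NonemptyLevel k → k ℤ.≤ ℓ)

θ : ℕ → ℤ → ℕ → ℤ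
θ b H z = ℤ.- (+ b) ℤ.- H ℤ.- + ⌊log₂ z ⌋

InInterval : ℤ → ℤ → ℤ → Set
InInterval lower upper k = lower ℤ.≤ k × k ℤ.≤ upper

-- The set {k | P k} has at most n elements: some list of length at most n
-- contains them all.
AtMost : ℕ → (ℤ → Set) → Set
AtMost n P = ∃[ ks ] length ks ℕ.≤ n × (∀ k → P k → k ∈ ks)

{-# OPTIONS --safe #-}

-- A nonempty level has Aₗ = 1 once W ℓ · 2^G < 1, and SS ℓ < 2^(b + ⌊log₂ z⌋ + 1) puts
-- every level below θ in that regime for both shifts; above top all levels are empty.
-- For the size of the interval, A H < 2^b together with SS top ≥ 2^(b-1) forces
-- top + H ≤ 0, while z < 2^b gives ⌊log₂ z⌋ ≤ b - 1.

module Submission where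

open import Data.Integer.Base as ℤ using (ℤ; +_; -[1+_]; 0ℤ; 1ℤ; _⊔_)
import Data.Integer.DivMod as ℤ
import Data.Integer.Properties as ℤ
open import Data.Integer.Tactic.RingSolver using (solve-∀)
open import Data.List.Base using (List; []; _∷_; foldr; length; map; upTo)
import Data.List.Properties as List
open import Data.List.Membership.Propositional using (_∈_)
open import Data.List.Membership.Propositional.Properties using (∈-map⁺; ∈-upTo⁺)
open import Data.List.Relation.Unary.All as All using (All)
import Data.List.Relation.Unary.All.Properties as All
open import Data.List.Relation.Unary.Any using (here; there)
open import Data.Nat.Base as ℕ using (ℕ; zero; suc; _^_; _*_; _∸_; ⌊_/2⌋)
open import Data.Nat.ListAction using (sum)
open import Data.Nat.Logarithm using (⌊log₂_⌋; ⌊log₂⌋-mono-≤; ⌊log₂⌊n/2⌋⌋≡⌊log₂n⌋∸1; ⌊log₂[2^n]⌋≡n)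
import Data.Nat.Properties as ℕ
open import Data.Product.Base using (_×_; _,_; proj₁; proj₂)
open import Data.Rational.Base as ℚ using (ℚ; floor; 0ℚ; 1ℚ; ½)
import Data.Rational.Properties as ℚ
import Data.Rational.Unnormalised.Base as ℚᵘ
import Data.Rational.Unnormalised.Properties as ℚᵘ
open import Data.Sum.Base using (inj₁; inj₂)
open import Function.Base using (_∘_)
open import Relation.Binary.PropositionalEquality
  using (_≡_; _≢_; refl; sym; trans; cong; subst; module ≡-Reasoning)
open import Relation.Nullary using (yes; no; contradiction)
open import Defs

-- Bounds relating a number to its binary logarithm.

n<2^1+⌊log₂n⌋ : ∀ n → n ℕ.< 2 ^ suc ⌊log₂ n ⌋
n<2^1+⌊log₂n⌋ n = ℕ.≰⇒> λ 2^≤n →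
  ℕ.1+n≰n (subst (ℕ._≤ ⌊log₂ n ⌋) (⌊log₂[2^n]⌋≡n _) (⌊log₂⌋-mono-≤ 2^≤n))

-- Monotonicity of the logarithm alone would only give `suc b`. The strict bound is used by
-- induction on `b`: halving `n` lowers both the logarithm and the exponent by one.
n<2^1+b⇒⌊log₂n⌋≤b : ∀ b n → n ℕ.< 2 ^ suc b → ⌊log₂ n ⌋ ℕ.≤ b
n<2^1+b⇒⌊log₂n⌋≤b zero    zero          _ = ℕ.z≤n
n<2^1+b⇒⌊log₂n⌋≤b zero    (suc zero)    _ = ℕ.z≤n
n<2^1+b⇒⌊log₂n⌋≤b zero    (suc (suc n)) (ℕ.s≤s (ℕ.s≤s ()))
n<2^1+b⇒⌊log₂n⌋≤b (suc b) n             n<2^ = begin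
  ⌊log₂ n ⌋              ≤⟨ ℕ.m≤n+m∸n _ 1 ⟩
  suc (⌊log₂ n ⌋ ∸ 1)    ≡⟨ cong suc (⌊log₂⌊n/2⌋⌋≡⌊log₂n⌋∸1 n) ⟨
  suc ⌊log₂ ⌊ n /2⌋ ⌋    ≤⟨ ℕ.s≤s (n<2^1+b⇒⌊log₂n⌋≤b b ⌊ n /2⌋ ⌊n/2⌋<2^) ⟩
  suc b                  ∎
  where
  open ℕ.≤-Reasoning
  2*⌊n/2⌋≤n : 2 * ⌊ n /2⌋ ℕ.≤ n
  2*⌊n/2⌋≤n = begin
    ⌊ n /2⌋ ℕ.+ (⌊ n /2⌋ ℕ.+ 0) ≡⟨ cong (⌊ n /2⌋ ℕ.+_) (ℕ.+-identityʳ _) ⟩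
    ⌊ n /2⌋ ℕ.+ ⌊ n /2⌋         ≤⟨ ℕ.+-monoʳ-≤ ⌊ n /2⌋ (ℕ.⌊n/2⌋≤⌈n/2⌉ n) ⟩
    ⌊ n /2⌋ ℕ.+ ℕ.⌈ n /2⌉       ≡⟨ ℕ.⌊n/2⌋+⌈n/2⌉≡n n ⟩
    n                           ∎
  ⌊n/2⌋<2^ : ⌊ n /2⌋ ℕ.< 2 ^ suc b
  ⌊n/2⌋<2^ = ℕ.*-cancelˡ-< 2 _ _ (ℕ.≤-<-trans 2*⌊n/2⌋≤n n<2^)

-- Transfer from unnormalised fractions, the embedding of the integers, and floors.

fromℚᵘ-mono-≤ : ∀ {p q} → p ℚᵘ.≤ q → ℚ.fromℚᵘ p ℚ.≤ ℚ.fromℚᵘ q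
fromℚᵘ-mono-≤ {p} {q} p≤q = ℚ.toℚᵘ-cancel-≤
  (ℚᵘ.≤-respˡ-≃ (ℚᵘ.≃-sym (ℚ.toℚᵘ-fromℚᵘ p)) (ℚᵘ.≤-respʳ-≃ (ℚᵘ.≃-sym (ℚ.toℚᵘ-fromℚᵘ q)) p≤q))

fromℚᵘ-mono-< : ∀ {p q} → p ℚᵘ.< q → ℚ.fromℚᵘ p ℚ.< ℚ.fromℚᵘ q
fromℚᵘ-mono-< {p} {q} p<q = ℚ.toℚᵘ-cancel-<
  (ℚᵘ.<-respˡ-≃ (ℚᵘ.≃-sym (ℚ.toℚᵘ-fromℚᵘ p)) (ℚᵘ.<-respʳ-≃ (ℚᵘ.≃-sym (ℚ.toℚᵘ-fromℚᵘ q)) p<q))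

fromℚᵘ-homo-* : ∀ p q → ℚ.fromℚᵘ (p ℚᵘ.* q) ≡ ℚ.fromℚᵘ p ℚ.* ℚ.fromℚᵘ q
fromℚᵘ-homo-* p q = ℚ.toℚᵘ-injective (begin
  ℚ.toℚᵘ (ℚ.fromℚᵘ (p ℚᵘ.* q))                    ≈⟨ ℚ.toℚᵘ-fromℚᵘ _ ⟩
  p ℚᵘ.* q                                        ≈⟨ ℚᵘ.*-cong (ℚ.toℚᵘ-fromℚᵘ p) (ℚ.toℚᵘ-fromℚᵘ q) ⟨
  ℚ.toℚᵘ (ℚ.fromℚᵘ p) ℚᵘ.* ℚ.toℚᵘ (ℚ.fromℚᵘ q)    ≈⟨ ℚ.toℚᵘ-homo-* (ℚ.fromℚᵘ p) (ℚ.fromℚᵘ q) ⟨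
  ℚ.toℚᵘ (ℚ.fromℚᵘ p ℚ.* ℚ.fromℚᵘ q)              ∎)
  where open ℚᵘ.≃-Reasoning

fromℤ : ℤ → ℚ
fromℤ i = i ℚ./ 1

fromℤ-mono-≤ : ∀ {i j} → i ℤ.≤ j → fromℤ i ℚ.≤ fromℤ j
fromℤ-mono-≤ {i} {j} i≤j = fromℚᵘ-mono-≤ {ℚᵘ.mkℚᵘ i 0} {ℚᵘ.mkℚᵘ j 0} (ℚᵘ.*≤* (ℤ.*-monoʳ-≤-nonNeg 1ℤ i≤j))

fromℤ-mono-< : ∀ {i j} → i ℤ.< j → fromℤ i ℚ.< fromℤ j
fromℤ-mono-< {i} {j} i<j = fromℚᵘ-mono-< {ℚᵘ.mkℚᵘ i 0} {ℚᵘ.mkℚᵘ j 0} (ℚᵘ.*<* (ℤ.*-monoʳ-<-pos 1ℤ i<j))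

-- Integer division gives `↥ p < (floor p + 1) * ↧ p`. Cancelling the positive denominator leaves
-- `i < floor p + 1`.
≤-floor : ∀ i p → fromℤ i ℚ.≤ p → i ℤ.≤ floor p
≤-floor i p@record{} i≤p = subst (i ℤ.≤_) (ℤ.pred-suc (floor p))
  (ℤ.i<j⇒i≤pred[j] {j = ℤ.suc (floor p)} (ℤ.*-cancelʳ-<-nonNeg (ℚ.↧ p) (begin-strict
    i ℤ.* ℚ.↧ p                           ≤⟨ ℚᵘ.drop-*≤* (ℚᵘ.≤-respˡ-≃ (ℚ.toℚᵘ-fromℚᵘ (ℚᵘ.mkℚᵘ i 0)) (ℚ.toℚᵘ-mono-≤ i≤p)) ⟩
    ℚ.↥ p ℤ.* 1ℤ                          ≡⟨ ℤ.*-identityʳ (ℚ.↥ p) ⟩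
    ℚ.↥ p                                 <⟨ ℤ.n<s[n/ℕd]*d (ℚ.↥ p) (ℚ.↧ₙ p) ⟩
    ℤ.suc (ℚ.↥ p ℤ./ℕ ℚ.↧ₙ p) ℤ.* ℚ.↧ p   ≡⟨ cong (λ n → ℤ.suc n ℤ.* ℚ.↧ p) (ℤ.div-pos-is-/ℕ (ℚ.↥ p) (ℚ.↧ₙ p)) ⟨
    ℤ.suc (floor p) ℤ.* ℚ.↧ p             ∎)))
  where open ℤ.≤-Reasoning

-- Uses the other half of integer division, `floor p * ↧ p ≤ ↥ p`, and again cancels the
-- denominator.
floor-< : ∀ i p → p ℚ.< fromℤ i → floor p ℤ.< i
floor-< i p@record{} p<i = ℤ.*-cancelʳ-<-nonNeg (ℚ.↧ p) (begin-strict
  floor p ℤ.* ℚ.↧ p   ≤⟨ ℤ.[n/d]*d≤n (ℚ.↥ p) (ℚ.↧ p) ⟩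
  ℚ.↥ p               ≡⟨ ℤ.*-identityʳ (ℚ.↥ p) ⟨
  ℚ.↥ p ℤ.* 1ℤ        <⟨ ℚᵘ.drop-*<* (ℚᵘ.<-respʳ-≃ (ℚ.toℚᵘ-fromℚᵘ (ℚᵘ.mkℚᵘ i 0)) (ℚ.toℚᵘ-mono-< p<i)) ⟩
  i ℤ.* ℚ.↧ p         ∎)
  where open ℤ.≤-Reasoning

-- Powers of two with integer exponents.

2^ᶻ-suc : ∀ i → 2^ᶻ (ℤ.suc i) ≡ fromℤ (+ 2) ℚ.* 2^ᶻ i
2^ᶻ-suc (+ n)        = trans (cong fromℤ (ℤ.pos-* 2 (2 ^ n)))
  (fromℚᵘ-homo-* (ℚᵘ.mkℚᵘ (+ 2) 0) (ℚᵘ.mkℚᵘ (+ (2 ^ n)) 0))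
2^ᶻ-suc -[1+ zero ]  = refl
2^ᶻ-suc -[1+ suc n ] =
  1/m≡2*1/2m (2 ^ suc n) {{ℕ.m^n≢0 2 (suc n)}} {{ℕ.m^n≢0 2 (suc (suc n))}}
  where
  -- The power is generalised to any nonzero `m`, so that it can be matched as a successor and the
  -- fractions compute.
  1/m≡2*1/2m : ∀ m .{{_ : ℕ.NonZero m}} .{{_ : ℕ.NonZero (2 * m)}} →
               1ℤ ℚ./ m ≡ fromℤ (+ 2) ℚ.* (1ℤ ℚ./ (2 * m))
  1/m≡2*1/2m m@(suc m-1) = trans
    (ℚ.fromℚᵘ-cong {ℚᵘ.mkℚᵘ 1ℤ m-1} {2ℚᵘ ℚᵘ.* (1ℤ ℚᵘ./ (2 * m))}
      (ℚᵘ.*≡* (cong +_ (trans (ℕ.*-identityˡ (1 * (2 * m))) (ℕ.*-identityˡ (2 * m))))))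
    (fromℚᵘ-homo-* 2ℚᵘ (1ℤ ℚᵘ./ (2 * m)))
    where 2ℚᵘ = ℚᵘ.mkℚᵘ (+ 2) 0

2^ᶻ-pred : ∀ i → 2^ᶻ (ℤ.pred i) ≡ ½ ℚ.* 2^ᶻ i
2^ᶻ-pred i = begin
  -- The inserted factor `½ * 2` evaluates to `1ℚ`, which reduces the claim to `2^ᶻ-suc`.
  2^ᶻ (ℤ.pred i)                              ≡⟨ ℚ.*-identityˡ _ ⟨
  (½ ℚ.* fromℤ (+ 2)) ℚ.* 2^ᶻ (ℤ.pred i)      ≡⟨ ℚ.*-assoc ½ (fromℤ (+ 2)) (2^ᶻ (ℤ.pred i)) ⟩
  ½ ℚ.* (fromℤ (+ 2) ℚ.* 2^ᶻ (ℤ.pred i))      ≡⟨ cong (½ ℚ.*_) (2^ᶻ-suc (ℤ.pred i)) ⟨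
  ½ ℚ.* 2^ᶻ (ℤ.suc (ℤ.pred i))                ≡⟨ cong (λ j → ½ ℚ.* 2^ᶻ j) (ℤ.suc-pred i) ⟩
  ½ ℚ.* 2^ᶻ i                                 ∎
  where open ≡-Reasoning

-- Induction on `i` away from zero in both directions, upwards by `2^ᶻ-suc` and downwards by
-- `2^ᶻ-pred`.
2^ᶻ-homo-+ : ∀ i j → 2^ᶻ (i ℤ.+ j) ≡ 2^ᶻ i ℚ.* 2^ᶻ j
2^ᶻ-homo-+ (+ zero) j = trans (cong 2^ᶻ_ (ℤ.+-identityˡ j)) (sym (ℚ.*-identityˡ (2^ᶻ j)))
2^ᶻ-homo-+ (+ suc n) j = begin
  2^ᶻ (+ suc n ℤ.+ j)                         ≡⟨ cong 2^ᶻ_ (ℤ.suc-+ n j) ⟩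
  2^ᶻ (ℤ.suc (+ n ℤ.+ j))                     ≡⟨ 2^ᶻ-suc (+ n ℤ.+ j) ⟩
  fromℤ (+ 2) ℚ.* 2^ᶻ (+ n ℤ.+ j)             ≡⟨ cong (fromℤ (+ 2) ℚ.*_) (2^ᶻ-homo-+ (+ n) j) ⟩
  fromℤ (+ 2) ℚ.* (2^ᶻ (+ n) ℚ.* 2^ᶻ j)       ≡⟨ ℚ.*-assoc (fromℤ (+ 2)) (2^ᶻ (+ n)) (2^ᶻ j) ⟨
  fromℤ (+ 2) ℚ.* 2^ᶻ (+ n) ℚ.* 2^ᶻ j         ≡⟨ cong (ℚ._* 2^ᶻ j) (2^ᶻ-suc (+ n)) ⟨
  2^ᶻ (+ suc n) ℚ.* 2^ᶻ j                     ∎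
  where open ≡-Reasoning
2^ᶻ-homo-+ -[1+ zero ] j = 2^ᶻ-pred j
2^ᶻ-homo-+ -[1+ suc n ] j = begin
  2^ᶻ (-[1+ suc n ] ℤ.+ j)                    ≡⟨ cong 2^ᶻ_ (ℤ.+-assoc -[1+ 0 ] -[1+ n ] j) ⟩
  2^ᶻ (ℤ.pred (-[1+ n ] ℤ.+ j))               ≡⟨ 2^ᶻ-pred (-[1+ n ] ℤ.+ j) ⟩
  ½ ℚ.* 2^ᶻ (-[1+ n ] ℤ.+ j)                  ≡⟨ cong (½ ℚ.*_) (2^ᶻ-homo-+ -[1+ n ] j) ⟩
  ½ ℚ.* (2^ᶻ -[1+ n ] ℚ.* 2^ᶻ j)              ≡⟨ ℚ.*-assoc ½ (2^ᶻ -[1+ n ]) (2^ᶻ j) ⟨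
  ½ ℚ.* 2^ᶻ -[1+ n ] ℚ.* 2^ᶻ j                ≡⟨ cong (ℚ._* 2^ᶻ j) (2^ᶻ-pred -[1+ n ]) ⟨
  2^ᶻ -[1+ suc n ] ℚ.* 2^ᶻ j                  ∎
  where open ≡-Reasoning

2^ᶻ-positive : ∀ i → ℚ.Positive (2^ᶻ i)
2^ᶻ-positive (+ n)    = ℚ.normalize-pos (2 ^ n) 1 {{_}} {{ℕ.m^n≢0 2 n}}
2^ᶻ-positive -[1+ n ] = ℚ.normalize-pos 1 (2 ^ suc n) {{ℕ.m^n≢0 2 (suc n)}}

*2^ᶻ-mono-≤ : ∀ i {p q} → p ℚ.≤ q → p ℚ.* 2^ᶻ i ℚ.≤ q ℚ.* 2^ᶻ i
*2^ᶻ-mono-≤ i = ℚ.*-monoʳ-≤-nonNeg (2^ᶻ i) {{ℚ.pos⇒nonNeg (2^ᶻ i) {{2^ᶻ-positive i}}}}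

*2^ᶻ-mono-< : ∀ i {p q} → p ℚ.< q → p ℚ.* 2^ᶻ i ℚ.< q ℚ.* 2^ᶻ i
*2^ᶻ-mono-< i = ℚ.*-monoˡ-<-pos (2^ᶻ i) {{2^ᶻ-positive i}}

i≤0⇒2^ᶻi≤1 : ∀ {i} → i ℤ.≤ 0ℤ → 2^ᶻ i ℚ.≤ 1ℚ
i≤0⇒2^ᶻi≤1 {+ zero}  _ = ℚ.≤-refl
i≤0⇒2^ᶻi≤1 {+ suc n} (ℤ.+≤+ ())
i≤0⇒2^ᶻi≤1 { -[1+ n ] } _ = 1/m≤1 (2 ^ suc n) {{ℕ.m^n≢0 2 (suc n)}}
  where
  1/m≤1 : ∀ m .{{_ : ℕ.NonZero m}} → 1ℤ ℚ./ m ℚ.≤ 1ℚ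
  1/m≤1 (suc m) = fromℚᵘ-mono-≤ {ℚᵘ.mkℚᵘ 1ℤ m} {ℚᵘ.1ℚᵘ} (ℚᵘ.*≤* (ℤ.+≤+ (ℕ.s≤s ℕ.z≤n)))

0≤i<1⇒i≡0 : ∀ {i} → 0ℤ ℤ.≤ i → i ℤ.< 1ℤ → i ≡ 0ℤ
0≤i<1⇒i≡0 0≤i i<1 = ℤ.≤-antisym (ℤ.i<j⇒i≤pred[j] i<1) 0≤i

-- Sums over lists and the number of integers in an interval.

sum≤length* : ∀ {m ns} → All (ℕ._≤ m) ns → sum ns ℕ.≤ length ns * m
sum≤length* All.[]            = ℕ.z≤n
sum≤length* (n≤m All.∷ ns≤m)  = ℕ.+-mono-≤ n≤m (sum≤length* ns≤m)

∈⇒≤sum : ∀ {n ns} → n ∈ ns → n ℕ.≤ sum ns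
∈⇒≤sum (here refl)          = ℕ.m≤m+n _ _
∈⇒≤sum (there {x = m} n∈ns) = ℕ.m≤n⇒m≤o+n m (∈⇒≤sum n∈ns)

sumℤ : List ℤ → ℤ
sumℤ = foldr ℤ._+_ 0ℤ

sumℤ-nonNeg : ∀ {is} → All (0ℤ ℤ.≤_) is → 0ℤ ℤ.≤ sumℤ is
sumℤ-nonNeg All.[]             = ℤ.≤-refl
sumℤ-nonNeg (0≤i All.∷ 0≤is)   = ℤ.+-mono-≤ 0≤i (sumℤ-nonNeg 0≤is)

∈⇒≤sumℤ : ∀ {i is} → All (0ℤ ℤ.≤_) is → i ∈ is → i ℤ.≤ sumℤ is
∈⇒≤sumℤ {i} {_ ∷ is} (0≤i All.∷ 0≤is) (here refl) =
  subst (ℤ._≤ i ℤ.+ sumℤ is) (ℤ.+-identityʳ i) (ℤ.+-monoʳ-≤ i (sumℤ-nonNeg 0≤is))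
∈⇒≤sumℤ {i} (0≤j All.∷ 0≤is) (there i∈is) =
  subst (ℤ._≤ _) (ℤ.+-identityˡ i) (ℤ.+-mono-≤ 0≤j (∈⇒≤sumℤ 0≤is i∈is))

-- The witness lists the `n` consecutive integers from `lower` on; `k` sits at index
-- `∣ k - lower ∣`, which is below `n`.
interval-atMost : ∀ n {lower upper} → upper ℤ.< lower ℤ.+ + n → AtMost n (InInterval lower upper)
interval-atMost n {lower} {upper} upper<lower+n =
  map (λ i → lower ℤ.+ + i) (upTo n) ,
  ℕ.≤-reflexive (trans (List.length-map _ (upTo n)) (List.length-upTo n)) ,
  λ k (lower≤k , k≤upper) →
    subst (_∈ map (λ i → lower ℤ.+ + i) (upTo n)) (lower+∣k-lower∣≡k lower≤k)
      (∈-map⁺ (λ i → lower ℤ.+ + i) (∈-upTo⁺ (ℤ.drop‿+<+ (+-cancelˡ-< lower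
        (subst (ℤ._< lower ℤ.+ + n) (sym (lower+∣k-lower∣≡k lower≤k))
          (ℤ.≤-<-trans k≤upper upper<lower+n))))))
  where
  i+[j-i]≡j : ∀ i j → i ℤ.+ (j ℤ.- i) ≡ j
  i+[j-i]≡j = solve-∀
  lower+∣k-lower∣≡k : ∀ {k} → lower ℤ.≤ k → lower ℤ.+ + ℤ.∣ k ℤ.- lower ∣ ≡ k
  lower+∣k-lower∣≡k {k} lower≤k =
    trans (cong (λ j → lower ℤ.+ j) (ℤ.0≤i⇒+∣i∣≡i (ℤ.i≤j⇒0≤j-i lower≤k))) (i+[j-i]≡j lower k)
  +-cancelˡ-< : ∀ i {j k} → i ℤ.+ j ℤ.< i ℤ.+ k → j ℤ.< k
  +-cancelˡ-< i i+j<i+k = ℤ.≰⇒> λ k≤j → ℤ.<⇒≱ i+j<i+k (ℤ.+-monoʳ-≤ i k≤j)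

-- Contributions of the levels of a configuration.

module _ {b} (c : Config b) where
  open Config c

  -- Level and shift merge into one exponent, so every estimate below depends only on `SS ℓ` and
  -- `ℓ + G`.
  W*2^G≡SS*2^[ℓ+G] : ∀ ℓ G → W ℓ ℚ.* 2^ᶻ G ≡ fromℤ (+ SS ℓ) ℚ.* 2^ᶻ (ℓ ℤ.+ G)
  W*2^G≡SS*2^[ℓ+G] ℓ G = trans (ℚ.*-assoc (fromℤ (+ SS ℓ)) (2^ᶻ ℓ) (2^ᶻ G))
    (cong (fromℤ (+ SS ℓ) ℚ.*_) (sym (2^ᶻ-homo-+ ℓ G)))

  floor[W*2^G]<1 : ∀ {k} ℓ G → SS ℓ ℕ.< 2 ^ k → + k ℤ.+ (ℓ ℤ.+ G) ℤ.≤ 0ℤ →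
                   floor (W ℓ ℚ.* 2^ᶻ G) ℤ.< 1ℤ
  floor[W*2^G]<1 {k} ℓ G SS<2^k k+ℓ+G≤0 = floor-< 1ℤ _ (begin-strict
    W ℓ ℚ.* 2^ᶻ G                           ≡⟨ W*2^G≡SS*2^[ℓ+G] ℓ G ⟩
    fromℤ (+ SS ℓ) ℚ.* 2^ᶻ (ℓ ℤ.+ G)        <⟨ *2^ᶻ-mono-< (ℓ ℤ.+ G) (fromℤ-mono-< (ℤ.+<+ SS<2^k)) ⟩
    2^ᶻ (+ k) ℚ.* 2^ᶻ (ℓ ℤ.+ G)             ≡⟨ 2^ᶻ-homo-+ (+ k) (ℓ ℤ.+ G) ⟨
    2^ᶻ (+ k ℤ.+ (ℓ ℤ.+ G))                 ≤⟨ i≤0⇒2^ᶻi≤1 k+ℓ+G≤0 ⟩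
    1ℚ                                      ∎)
    where open ℚ.≤-Reasoning

  0≤floor[W*2^G] : ∀ ℓ G → 0ℤ ℤ.≤ floor (W ℓ ℚ.* 2^ᶻ G)
  0≤floor[W*2^G] ℓ G = ≤-floor 0ℤ _ (begin
    0ℚ                                      ≡⟨ ℚ.*-zeroˡ (2^ᶻ (ℓ ℤ.+ G)) ⟨
    0ℚ ℚ.* 2^ᶻ (ℓ ℤ.+ G)                    ≤⟨ *2^ᶻ-mono-≤ (ℓ ℤ.+ G) (fromℤ-mono-≤ (ℤ.+≤+ (ℕ.z≤n {SS ℓ}))) ⟩
    fromℤ (+ SS ℓ) ℚ.* 2^ᶻ (ℓ ℤ.+ G)        ≡⟨ W*2^G≡SS*2^[ℓ+G] ℓ G ⟨
    W ℓ ℚ.* 2^ᶻ G                           ∎)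
    where open ℚ.≤-Reasoning

  -- Since `ℓ + G` is a natural number, the lower bound is itself an integer and survives the floor.
  2^[k+n]≤floor[W*2^G] : ∀ {k} n ℓ G → 2 ^ k ℕ.≤ SS ℓ → ℓ ℤ.+ G ≡ + n →
                         + (2 ^ (k ℕ.+ n)) ℤ.≤ floor (W ℓ ℚ.* 2^ᶻ G)
  2^[k+n]≤floor[W*2^G] {k} n ℓ G 2^k≤SS ℓ+G≡n = ≤-floor _ _ (begin
    2^ᶻ (+ k ℤ.+ + n)                       ≡⟨ 2^ᶻ-homo-+ (+ k) (+ n) ⟩
    2^ᶻ (+ k) ℚ.* 2^ᶻ (+ n)                 ≤⟨ *2^ᶻ-mono-≤ (+ n) (fromℤ-mono-≤ (ℤ.+≤+ 2^k≤SS)) ⟩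
    fromℤ (+ SS ℓ) ℚ.* 2^ᶻ (+ n)            ≡⟨ cong (λ i → fromℤ (+ SS ℓ) ℚ.* 2^ᶻ i) ℓ+G≡n ⟨
    fromℤ (+ SS ℓ) ℚ.* 2^ᶻ (ℓ ℤ.+ G)        ≡⟨ W*2^G≡SS*2^[ℓ+G] ℓ G ⟨
    W ℓ ℚ.* 2^ᶻ G                           ∎)
    where open ℚ.≤-Reasoning

  SS≡0⇒Aₗ≡0 : ∀ ℓ G → SS ℓ ≡ 0 → Aₗ ℓ G ≡ 0ℤ
  SS≡0⇒Aₗ≡0 ℓ G eq with SS ℓ
  ... | zero = refl

  SS≢0⇒Aₗ≡floor+1 : ∀ ℓ G → SS ℓ ≢ 0 → Aₗ ℓ G ≡ floor (W ℓ ℚ.* 2^ᶻ G) ℤ.+ 1ℤ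
  SS≢0⇒Aₗ≡floor+1 ℓ G ne with SS ℓ in eq
  ... | zero  = contradiction refl ne
  -- The unfolded `Aₗ` still mentions `SS ℓ`, while the right-hand side now has `suc n`; `eq`
  -- reconciles them.
  ... | suc n = cong (λ n → floor (((+ n ℚ./ 1) ℚ.* 2^ᶻ ℓ) ℚ.* 2^ᶻ G) ℤ.+ 1ℤ) eq

  -- One level holds at most `z` significands, each below `2 ^ b`, and `z` is below
  -- `2 ^ suc ⌊log₂ z ⌋`.
  SS<2^ : ∀ {ℓ} → ℓ ∈ levels → SS ℓ ℕ.< 2 ^ (suc ⌊log₂ z ⌋ ℕ.+ b)
  SS<2^ {ℓ} ℓ∈levels = begin-strict
    SS ℓ                              ≤⟨ sum≤length* (All.map (ℕ.<⇒≤ ∘ proj₂) (normalized ℓ)) ⟩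
    length (contents ℓ) * 2 ^ b       ≤⟨ ℕ.*-monoˡ-≤ (2 ^ b) (∈⇒≤sum (∈-map⁺ (length ∘ contents) ℓ∈levels)) ⟩
    z * 2 ^ b                         <⟨ ℕ.*-monoˡ-< (2 ^ b) {{ℕ.m^n≢0 2 b}} (n<2^1+⌊log₂n⌋ z) ⟩
    2 ^ suc ⌊log₂ z ⌋ * 2 ^ b         ≡⟨ ℕ.^-distribˡ-+-* 2 (suc ⌊log₂ z ⌋) b ⟨
    2 ^ (suc ⌊log₂ z ⌋ ℕ.+ b)         ∎
    where open ℕ.≤-Reasoning

  2^[b∸1]≤SS : ∀ {ℓ} → contents ℓ ≢ [] → 2 ^ (b ∸ 1) ℕ.≤ SS ℓ
  2^[b∸1]≤SS {ℓ} ne with contents ℓ | normalized ℓ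
  ... | []     | _                    = contradiction refl ne
  ... | s ∷ ss | (2^≤s , _) All.∷ _   = ℕ.m≤n⇒m≤n+o (sum ss) 2^≤s

  Aₗ-nonNeg : ∀ ℓ G → 0ℤ ℤ.≤ Aₗ ℓ G
  Aₗ-nonNeg ℓ G with SS ℓ ℕ.≟ 0
  ... | yes SS≡0 = ℤ.≤-reflexive (sym (SS≡0⇒Aₗ≡0 ℓ G SS≡0))
  ... | no  SS≢0 = subst (0ℤ ℤ.≤_) (sym (SS≢0⇒Aₗ≡floor+1 ℓ G SS≢0))
    (ℤ.+-mono-≤ (0≤floor[W*2^G] ℓ G) (ℤ.+≤+ (ℕ.z≤n {1})))

  Aₗ≤A : ∀ {ℓ} G → ℓ ∈ levels → Aₗ ℓ G ℤ.≤ A G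
  Aₗ≤A G ℓ∈levels = ∈⇒≤sumℤ
    (All.map⁺ (All.universal (λ k → Aₗ-nonNeg k G) levels))
    (∈-map⁺ (λ k → Aₗ k G) ℓ∈levels)

  -- Below the threshold the scaled weight lies in `[0, 1)`, so its floor vanishes. Allowing any
  -- `G ≤ H` lets one threshold serve both shifts.
  ℓ<θ⇒Aₗ≡1 : ∀ {ℓ G H} → ℓ ∈ levels → SS ℓ ≢ 0 → G ℤ.≤ H → ℓ ℤ.< θ b H z → Aₗ ℓ G ≡ 1ℤ
  ℓ<θ⇒Aₗ≡1 {ℓ} {G} {H} ℓ∈levels SS≢0 G≤H ℓ<θ = trans (SS≢0⇒Aₗ≡floor+1 ℓ G SS≢0)
    (cong (ℤ._+ 1ℤ) (0≤i<1⇒i≡0 (0≤floor[W*2^G] ℓ G) (floor[W*2^G]<1 ℓ G (SS<2^ ℓ∈levels) exponent≤0)))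
    where
    L = + ⌊log₂ z ⌋
    regroup : ∀ L b ℓ G → (1ℤ ℤ.+ (L ℤ.+ b)) ℤ.+ (ℓ ℤ.+ G) ≡ (1ℤ ℤ.+ ℓ) ℤ.+ (L ℤ.+ b ℤ.+ G)
    regroup = solve-∀
    cancel : ∀ L b H → (ℤ.- b ℤ.- H ℤ.- L) ℤ.+ (L ℤ.+ b ℤ.+ H) ≡ 0ℤ
    cancel = solve-∀
    open ℤ.≤-Reasoning
    exponent≤0 : + (suc ⌊log₂ z ⌋ ℕ.+ b) ℤ.+ (ℓ ℤ.+ G) ℤ.≤ 0ℤ
    exponent≤0 = begin
      + (suc ⌊log₂ z ⌋ ℕ.+ b) ℤ.+ (ℓ ℤ.+ G)     ≡⟨ regroup L (+ b) ℓ G ⟩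
      -- Strictness of `ℓ < θ` absorbs the extra one in the exponent `suc ⌊log₂ z ⌋`.
      ℤ.suc ℓ ℤ.+ (L ℤ.+ + b ℤ.+ G)             ≤⟨ ℤ.+-mono-≤ (ℤ.i<j⇒suc[i]≤j ℓ<θ) (ℤ.+-monoʳ-≤ (L ℤ.+ + b) G≤H) ⟩
      θ b H z ℤ.+ (L ℤ.+ + b ℤ.+ H)             ≡⟨ cancel L (+ b) H ⟩
      0ℤ                                        ∎

  contents≢[]⇒SS≢0 : ∀ {ℓ} → contents ℓ ≢ [] → SS ℓ ≢ 0
  contents≢[]⇒SS≢0 ne SS≡0 = ℕ.<⇒≢ (ℕ.<-≤-trans (ℕ.m^n>0 2 (b ∸ 1)) (2^[b∸1]≤SS ne)) (sym SS≡0)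

  -- If `top + G ≥ 1`, a single significand of size at least `2 ^ (b ∸ 1)` already makes the
  -- contribution of `top` at least `2 ^ b`. Contributions are nonnegative, so `A G` is at least as
  -- large.
  A<2^b⇒top+G≤0 : ∀ {top} G → NonemptyLevel top → A G ℤ.< + (2 ^ b) → top ℤ.+ G ℤ.≤ 0ℤ
  A<2^b⇒top+G≤0 {top} G (top∈levels , ne) A<2^b = ℤ.≮⇒≥ absurd
    where
    open ℤ.≤-Reasoning
    n = ℤ.∣ top ℤ.+ G ∣
    b≤b∸1+n : 0 ℕ.< n → b ℕ.≤ b ∸ 1 ℕ.+ n
    b≤b∸1+n 0<n = ℕ.≤-trans
      (subst (b ℕ.≤_) (ℕ.+-comm 1 (b ∸ 1)) (ℕ.m≤n+m∸n b 1))
      (ℕ.+-monoʳ-≤ (b ∸ 1) 0<n)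
    absurd : 0ℤ ℤ.≮ top ℤ.+ G
    absurd 0<top+G = ℤ.<-irrefl refl (begin-strict
      + (2 ^ b)                        ≤⟨ ℤ.+≤+ (ℕ.^-monoʳ-≤ 2 (b≤b∸1+n 0<n)) ⟩
      + (2 ^ (b ∸ 1 ℕ.+ n))            ≤⟨ 2^[k+n]≤floor[W*2^G] {b ∸ 1} n top G (2^[b∸1]≤SS ne) (sym n≡top+G) ⟩
      floor (W top ℚ.* 2^ᶻ G)          ≤⟨ ℤ.i≤i+j _ 1ℤ ⟩
      floor (W top ℚ.* 2^ᶻ G) ℤ.+ 1ℤ   ≡⟨ SS≢0⇒Aₗ≡floor+1 top G (contents≢[]⇒SS≢0 ne) ⟨
      Aₗ top G                         ≤⟨ Aₗ≤A G top∈levels ⟩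
      A G                              <⟨ A<2^b ⟩
      + (2 ^ b)                        ∎)
      where
      n≡top+G : + n ≡ top ℤ.+ G
      n≡top+G = ℤ.0≤i⇒+∣i∣≡i (ℤ.<⇒≤ 0<top+G)
      0<n : 0 ℕ.< n
      0<n = ℤ.drop‿+<+ (subst (0ℤ ℤ.<_) (sym n≡top+G) 0<top+G)

  -- An empty level contributes 0 under both shifts and a nonempty one below the threshold
  -- contributes 1 under both, so a differing level is nonempty and not below `θ`.
  Aₗ≢⇒θ≤ℓ≤top : ∀ {top ℓ G G′} → LargestNonemptyLevel top → ℓ ∈ levels →
                 Aₗ ℓ G ≢ Aₗ ℓ G′ → InInterval (θ b (G ⊔ G′) z) top ℓ
  Aₗ≢⇒θ≤ℓ≤top {top} {ℓ} {G} {G′} (_ , ≤top) ℓ∈levels A≢A′ =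
    ℤ.≮⇒≥ (λ ℓ<θ → A≢A′ (trans
      (ℓ<θ⇒Aₗ≡1 ℓ∈levels SS≢0 (ℤ.i≤i⊔j G G′) ℓ<θ)
      (sym (ℓ<θ⇒Aₗ≡1 ℓ∈levels SS≢0 (ℤ.i≤j⊔i G G′) ℓ<θ)))) ,
    ≤top ℓ (ℓ∈levels , SS≢0 ∘ cong sum)
    where
    SS≢0 : SS ℓ ≢ 0
    SS≢0 SS≡0 = A≢A′ (trans (SS≡0⇒Aₗ≡0 ℓ G SS≡0) (sym (SS≡0⇒Aₗ≡0 ℓ G′ SS≡0)))

  -- Here `θ + 2b = b - H - ⌊log₂ z ⌋`, which exceeds `- H ≥ top` because `⌊log₂ z ⌋ < b`.
  top+H≤0⇒top<θ+2b : ∀ {top H} → 1 ℕ.≤ b → top ℤ.+ H ℤ.≤ 0ℤ → top ℤ.< θ b H z ℤ.+ + (2 * b)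
  top+H≤0⇒top<θ+2b {top} {H} 1≤b top+H≤0 = begin-strict
    top                                         ≡⟨ split top H ⟩
    top ℤ.+ H ℤ.+ ℤ.- H                         ≤⟨ ℤ.+-monoˡ-≤ (ℤ.- H) top+H≤0 ⟩
    0ℤ ℤ.+ ℤ.- H                                ≡⟨ insert L H ⟩
    L ℤ.+ (ℤ.- H ℤ.- L)                         <⟨ ℤ.+-monoˡ-< (ℤ.- H ℤ.- L) (ℤ.+<+ L<b) ⟩
    + b ℤ.+ (ℤ.- H ℤ.- L)                       ≡⟨ regroup L (+ b) H ⟩
    θ b H z ℤ.+ + 2 ℤ.* + b                     ≡⟨ cong (λ i → θ b H z ℤ.+ i) (ℤ.pos-* 2 b) ⟨
    θ b H z ℤ.+ + (2 * b)                       ∎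
    where
    open ℤ.≤-Reasoning
    L = + ⌊log₂ z ⌋
    split : ∀ t H → t ≡ t ℤ.+ H ℤ.+ ℤ.- H
    split = solve-∀
    insert : ∀ L H → 0ℤ ℤ.+ ℤ.- H ≡ L ℤ.+ (ℤ.- H ℤ.- L)
    insert = solve-∀
    regroup : ∀ L b H → b ℤ.+ (ℤ.- H ℤ.- L) ≡ (ℤ.- b ℤ.- H ℤ.- L) ℤ.+ + 2 ℤ.* b
    regroup = solve-∀
    1+[b∸1]≡b : suc (b ∸ 1) ≡ b
    1+[b∸1]≡b = ℕ.m+[n∸m]≡n 1≤b
    L<b : ⌊log₂ z ⌋ ℕ.< b
    L<b = subst (⌊log₂ z ⌋ ℕ.<_) 1+[b∸1]≡b (ℕ.s≤s
      -- The bound `z < 2 ^ b` is restated with exponent `suc (b ∸ 1)`, giving `⌊log₂ z ⌋ ≤ b ∸ 1`.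
      (n<2^1+b⇒⌊log₂n⌋≤b (b ∸ 1) z (subst (λ e → z ℕ.< 2 ^ e) (sym 1+[b∸1]≡b) z<2^b)))

mainTheorem12 : (b : ℕ) → 2 ℕ.≤ b → (c : Config b) → let open Config c in
    1 ℕ.≤ z →
    (top : ℤ) → LargestNonemptyLevel top →
    (G G′ : ℤ) → A G ℤ.< + (2 ^ b) → A G′ ℤ.< + (2 ^ b) →
    (∀ ℓ → ℓ ∈ levels → Aₗ ℓ G ≢ Aₗ ℓ G′ → InInterval (θ b (G ⊔ G′) z) top ℓ)
    × AtMost (2 * b) (InInterval (θ b (G ⊔ G′) z) top)
    × AtMost (2 * b) (λ ℓ → ℓ ∈ levels × Aₗ ℓ G ≢ Aₗ ℓ G′)
mainTheorem12 b 2≤b c _ top largest G G′ A<2^b A′<2^b =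
  within ,
  few ,
  proj₁ few , proj₁ (proj₂ few) , λ ℓ (ℓ∈levels , A≢A′) → proj₂ (proj₂ few) ℓ (within ℓ ℓ∈levels A≢A′)
  where
  open Config c
  H = G ⊔ G′
  within : ∀ ℓ → ℓ ∈ levels → Aₗ ℓ G ≢ Aₗ ℓ G′ → InInterval (θ b H z) top ℓ
  within ℓ = Aₗ≢⇒θ≤ℓ≤top c largest
  -- The maximum equals one of the two shifts and inherits its bound.
  A[H]<2^b : A H ℤ.< + (2 ^ b)
  A[H]<2^b with ℤ.⊔-sel G G′
  ... | inj₁ H≡G  = subst (λ K → A K ℤ.< + (2 ^ b)) (sym H≡G) A<2^b
  ... | inj₂ H≡G′ = subst (λ K → A K ℤ.< + (2 ^ b)) (sym H≡G′) A′<2^b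
  few : AtMost (2 * b) (InInterval (θ b H z) top)
  few = interval-atMost (2 * b)
    (top+H≤0⇒top<θ+2b c (ℕ.<⇒≤ 2≤b) (A<2^b⇒top+G≤0 c H (proj₁ largest) A[H]<2^b))
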